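{- Let $q$ be a prime power and $m\ge 1$ an odd integer, and consider $\mathbb{P}(m,\mathbb{GF}(q))$ with the partition of its points, and the corresponding partition of its hyperplanes, described in the context. Then each point of $\mathbb{P}(m,\mathbb{GF}(q))$ is contained in exactly $$\frac{q^{(m+1)/2}-1}{q-1}$$ hyperplanes belonging to the unique block of the partition that contains this point, and in exactly $$\frac{q^{m}-q^{(m+1)/2}}{q-1}$$ hyperplanes from the remaining blocks of the partition, which do not contain this point.
   Context: $\mathbb{P}(m,\mathbb{GF}(q))$ is the projective space of the $(m+1)$-dimensional $\mathbb{GF}(q)$-vector space $\mathbb{V}=\mathbb{GF}(q^{m+1})$; points are its 1-dimensional and hyperplanes its $m$-dimensional $\mathbb{GF}(q)$-subspaces. Since $m+1$ is even, $\mathbb{GF}(q^{(m+1)/2})$ is a subfield of $\mathbb{GF}(q^{m+1})$. The cosets of its multiplicative group in the multiplicative group of $\mathbb{GF}(q^{m+1})$, each together with $0$, are $\frac{m+1}{2}$-dimensional $\mathbb{GF}(q)$-subspaces $W_1,\dots,W_N$, where $N=\frac{q^{m+1}-1}{q^{(m+1)/2}-1}$. The partition of points has as its blocks the sets of points contained in $W_1,\dots,W_N$ respectively. The corresponding partition of hyperplanes has as its $i$-th block the set of hyperplanes containing $W_i$. "Hyperplanes belonging to the block that contains the point $a$" means the hyperplanes containing $W_i$, where $W_i$ is the unique subspace containing $a$; hyperplanes from the remaining blocks are those containing some $W_j$, $j\ne i$. -}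

module Defs where

open import Level using (Level; _⊔_) renaming (suc to lsuc)
open import Algebra.Apartness.Bundles using (HeytingField; HeytingCommutativeRing)
open import Algebra.Bundles using (CommutativeRing)
import Algebra.Properties.Semiring.Sum as SemiringSum
open import Data.Fin.Base using (Fin)
open import Data.Nat.Base as ℕ using (ℕ; _≤_)
open import Data.Nat.Divisibility using (_∣_; quotient)
open import Data.Nat.Primality using (Prime)
open import Data.Product.Base using (Σ; ∃; _×_; proj₁)
open import Data.Sum.Base using (_⊎_)
open import Data.Vec.Functional using (Vector)
open import Function.Bundles using (Inverse)
open import Relation.Binary.Bundles using (Setoid)
import Relation.Binary.Construct.On as On
open import Relation.Binary.Definitions using (_Respects_)
open import Relation.Binary.PropositionalEquality using (_≡_)
import Relation.Binary.PropositionalEquality.Properties as ≡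
open import Relation.Nullary.Negation.Core using (¬_)
open import Relation.Unary using (Pred; _∈_; _⊆_; _≐_)
open import Relation.Unary.Relation.Binary.Equality using (≐-setoid)

private
  variable
    a ℓ p : Level

IsPrimePower : ℕ → Set
IsPrimePower q = ∃ λ r → ∃ λ e → Prime r × 1 ≤ e × q ≡ r ℕ.^ e

-- Elements are compared through the ambient equality; the membership
-- proofs are ignored, so an element is never counted twice.
Restrict : (S : Setoid a ℓ) → Pred (Setoid.Carrier S) p → Setoid (a ⊔ p) ℓ
Restrict S P = On.setoid {B = Σ (Setoid.Carrier S) P} S proj₁

HasCardinality : Setoid a ℓ → ℕ → Set (a ⊔ ℓ)
HasCardinality S n = Inverse S (≡.setoid (Fin n))

-- S has exactly n / d elements, where the fraction is exact (not rounded
-- down): divisibility is part of the claim.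
HasCardinalityRatio : Setoid a ℓ → (n d : ℕ) → Set (a ⊔ ℓ)
HasCardinalityRatio S n d = Σ (d ∣ n) λ d∣n → HasCardinality S (quotient d∣n)

-- In a finite HeytingField apartness coincides with _≉_, so finite Heyting
-- fields are exactly finite fields.
module _ {c ℓ₁ ℓ₂} (𝕃 : HeytingField c ℓ₁ ℓ₂) where

  open HeytingField 𝕃
  open CommutativeRing (HeytingCommutativeRing.commutativeRing heytingCommutativeRing)
    using (semiring)
  open SemiringSum semiring using (sum)

  fieldSetoid : Setoid c ℓ₁
  fieldSetoid = setoid

  Subset : Set (lsuc (c ⊔ ℓ₁))
  Subset = Pred Carrier (c ⊔ ℓ₁)

  subsets : Setoid (lsuc (c ⊔ ℓ₁)) (c ⊔ ℓ₁)
  subsets = ≐-setoid Carrier (c ⊔ ℓ₁)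

  record IsSubfield (F : Subset) : Set (c ⊔ ℓ₁) where
    field
      resp       : F Respects _≈_
      0∈         : 0# ∈ F
      1∈         : 1# ∈ F
      +-closed   : ∀ {x y} → x ∈ F → y ∈ F → x + y ∈ F
      -‿closed   : ∀ {x} → x ∈ F → - x ∈ F
      *-closed   : ∀ {x y} → x ∈ F → y ∈ F → x * y ∈ F
      inv-closed : ∀ {x y} → x ∈ F → x * y ≈ 1# → y ∈ F

  -- The coset g E* of the multiplicative group of E, together with 0.
  -- The subspaces W₁, …, W_N are the W E g with g nonzero; several g give the
  -- same one, so "j ≠ i" is expressed by W E h and W E g being different sets.
  W : (E : Subset) → Carrier → Subset
  W E g x = x ≈ 0# ⊎ (∃ λ e → e ∈ E × ¬ (e ≈ 0#) × x ≈ g * e)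

  SameBlock : (E : Subset) → Carrier → Carrier → Set (c ⊔ ℓ₁)
  SameBlock E g h = W E g ≐ W E h

  -- The point P belongs to the block of points given by W E g.
  InPointBlock : (E P : Subset) → Carrier → Set (c ⊔ ℓ₁)
  InPointBlock E P g = ¬ (g ≈ 0#) × P ⊆ W E g

  module _ (F : Subset) where

    record IsSubspace (U : Subset) : Set (c ⊔ ℓ₁) where
      field
        resp     : U Respects _≈_
        0∈       : 0# ∈ U
        +-closed : ∀ {x y} → x ∈ U → y ∈ U → x + y ∈ U
        *-closed : ∀ {s x} → s ∈ F → x ∈ U → s * x ∈ U

    combination : ∀ {n} → Vector Carrier n → Vector Carrier n → Carrier
    combination s v = sum (λ i → s i * v i)

    record IsBasis (U : Subset) {n : ℕ} (v : Vector Carrier n) : Set (c ⊔ ℓ₁) where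
      field
        inside      : ∀ i → v i ∈ U
        spanning    : ∀ {x} → x ∈ U →
                      ∃ λ s → (∀ i → s i ∈ F) × x ≈ combination s v
        independent : ∀ s → (∀ i → s i ∈ F) →
                      combination s v ≈ 0# → ∀ i → s i ≈ 0#

    HasDimension : ℕ → Subset → Set (c ⊔ ℓ₁)
    HasDimension n U = ∃ λ (v : Vector Carrier n) → IsBasis U v

    IsPoint : Subset → Set (c ⊔ ℓ₁)
    IsPoint U = IsSubspace U × HasDimension 1 U

    IsHyperplane : ℕ → Subset → Set (c ⊔ ℓ₁)
    IsHyperplane m U = IsSubspace U × HasDimension m U

    InHyperplaneBlock : (E : Subset) → ℕ → Carrier → Subset → Set (c ⊔ ℓ₁)
    InHyperplaneBlock E m g H = IsHyperplane m H × W E g ⊆ H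

    InOtherHyperplaneBlock : (E : Subset) → ℕ → Carrier → Subset → Set (c ⊔ ℓ₁)
    InOtherHyperplaneBlock E m g H =
      ∃ λ h → ¬ (h ≈ 0#) × ¬ SameBlock E h g × InHyperplaneBlock E m h H

{-# OPTIONS --safe #-}

-- By Fermat and root counting, E is the set of roots of X ^ |E| - X, hence F ⊆ E, and E can be
-- enlarged to an F-hyperplane K of 𝕃.  Pigeonhole shows that every hyperplane is a⁻¹ K for some
-- a ≠ 0, and a is unique up to F*, because only elements of F stabilise K.  Moreover
-- g E ⊆ a⁻¹ K holds exactly when a g ∈ E, because 𝕃 = E + a g E otherwise.  So the hyperplanes
-- through g E are parametrised by a g ∈ E* modulo F*, and those through the point F p that
-- belong to other blocks by a p ∈ K ∖ E modulo F*.
module Submission where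

open import Defs
open import Algebra.Apartness.Bundles using (HeytingField; HeytingCommutativeRing)
open import Algebra.Bundles using (CommutativeRing)
import Algebra.Properties.CommutativeMonoid.Sum as Sum
import Algebra.Properties.Ring as RingProperties
import Algebra.Properties.Semiring.Exp as Exp
import Algebra.Properties.Semiring.Sum as SemiringSum
import Algebra.Solver.Ring.NaturalCoefficients.Default as SemiringSolver
open import Data.Fin.Base
  using (Fin; zero; suc; splitAt; join; combine; remQuot; finToFun; funToFin)
open import Data.Fin.Permutation using (Permutation′; permutation)
open import Data.Fin.Properties
  using (any?; injective⇒≤; suc-injective; combine-remQuot; remQuot-combine;
         funToFin-finToFin; finToFun-funToFin; splitAt-join; join-splitAt)
  renaming (_≟_ to _≟ᶠ_)
open import Data.Nat.Base as ℕ
  using (ℕ; zero; suc; _≤_; _<_; _∸_; _^_; _/_; z≤n; s≤s; _≤′_; ≤′-refl; ≤′-step)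
open import Data.Nat.Divisibility using (_∤_; divides)
open import Data.Nat.DivMod using (_%_; m%n<n; m≡m%n+[m/n]*n; m/n<m)
open import Data.Nat.Properties
  using (≤-antisym; <⇒≱; <⇒≤; m+n∸n≡m; ≤-refl; ≤-reflexive; ≤⇒≤′; ^-monoʳ-<; n<1+n; ^-*-assoc;
         m≤n⇒m≤1+n; ≤-pred)
  renaming (suc-injective to ℕ-suc-injective)
open import Data.Product using (Σ; ∃; ∃!; _×_; _,_; proj₁; proj₂; map₂; uncurry)
open import Data.Sum using (_⊎_; inj₁; inj₂)
open import Data.Unit.Polymorphic using (⊤; tt)
open import Data.Vec.Functional using (Vector; _∷_; []; tail)
open import Data.Vec.Functional.Relation.Binary.Equality.Setoid using (≋-setoid)
open import Function.Base using (_∘_; case_of_)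
open import Function.Bundles using (Inverse)
open import Level using (Level)
open import Relation.Binary.Bundles using (Setoid)
open import Relation.Binary.Definitions using (Decidable; _Respects_)
open import Relation.Binary.PropositionalEquality as ≡ using (_≡_)
import Relation.Binary.Reasoning.Setoid as ≈-Reasoning
open import Relation.Nullary using (¬_; Dec; yes; no; ¬?)
open import Relation.Nullary.Decidable using (map′; decidable-stable; _×-dec_)
open import Relation.Nullary.Negation using (contradiction)
open import Relation.Unary as U using (Pred; _∈_; _∉_; _⊆_; _≐_)

-- Hyperplanes are arbitrary predicates compared by mutual inclusion, so they can neither be listed
-- nor told apart directly. The proof therefore works with multipliers in 𝕃, where finiteness makes
-- equality and searches decidable, and transfers the result along `a ↦ H a`. `K` serves as the
-- kernel of one `F`-linear functional, and multiplication in 𝕃 turns it into all the others, much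
-- as a trace form would. For any hyperplane `K` the multipliers carrying `E` into `K` form a
-- one-dimensional `E`-space; requiring that `K` contain `E` makes this space `E` itself, which is
-- why the incidence condition is simply membership in `E`. Dimension arguments are replaced by
-- counting: an injection between finite sets of equal size is onto, and a set with more elements
-- than a span has one outside it. Finally, `F*` acts freely on the multipliers, and counting its
-- orbits yields at once the divisibility by `q ∸ 1` and the quotient.

private
  variable
    α β γ ρ ℓ ℓ₁ ℓ₂ ℓ₃ : Level

-- Finite setoids: pigeonhole arguments and orbit counting.

module _ (S : Setoid α ℓ) where
  open Setoid S

  enumeration⇒cardinality : ∀ {n} (f : Fin n → Carrier) →
    (∀ {i j} → f i ≈ f j → i ≡ j) → (∀ x → ∃ λ i → f i ≈ x) → HasCardinality S n
  enumeration⇒cardinality f inj surj = record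
    { to        = proj₁ ∘ surj
    ; from      = f
    ; to-cong   = λ {x} {y} x≈y → inj (trans (proj₂ (surj x)) (trans x≈y (sym (proj₂ (surj y)))))
    ; from-cong = λ { ≡.refl → refl }
    ; inverse   = (λ {x} {y} y≈ → inj (trans (proj₂ (surj y)) y≈))
                , (λ { {x} ≡.refl → proj₂ (surj x) })
    }

module Finite {S : Setoid α ℓ} {n} (I : HasCardinality S n) where
  open Setoid S
  open Inverse I public using (to; from; to-cong)

  from-to : ∀ x → from (to x) ≈ x
  from-to x = Inverse.inverseʳ I ≡.refl

  to-injective : ∀ {x y} → to x ≡ to y → x ≈ y
  to-injective {x} {y} eq = trans (sym (from-to x)) (trans (reflexive (≡.cong from eq)) (from-to y))

  from-injective : ∀ {i j} → from i ≈ from j → i ≡ j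
  from-injective eq = ≡.trans (≡.sym (Inverse.inverseˡ I refl))
    (≡.trans (to-cong eq) (Inverse.inverseˡ I refl))

  _≈?_ : Decidable _≈_
  x ≈? y = map′ to-injective to-cong (to x ≟ᶠ to y)

  any-element? : ∀ {P : Pred Carrier ρ} → P Respects _≈_ → U.Decidable P → Dec (∃ P)
  any-element? resp P? = map′ (λ (i , Pi) → from i , Pi)
    (λ (x , Px) → to x , resp (sym (from-to x)) Px) (any? (λ i → P? (from i)))

module _ {S : Setoid α ℓ₁} {T : Setoid β ℓ₂} {m n}
         (I : HasCardinality S m) (J : HasCardinality T n) where
  private
    module S = Setoid S
    module T = Setoid T
    module I = Finite I
    module J = Finite J

  injection⇒≤ : (f : S.Carrier → T.Carrier) →
    (∀ {x y} → f x T.≈ f y → x S.≈ y) → m ≤ n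
  injection⇒≤ f inj = injective⇒≤ {f = J.to ∘ f ∘ I.from}
    (λ eq → I.from-injective (inj (J.to-injective eq)))

  -- A missed `t` could be put in front of the values of `f`, giving an injection from `Fin (suc m)`
  -- to `Fin n` against `n ≤ m`.
  injection⇒surjection : (f : S.Carrier → T.Carrier) →
    (∀ {x y} → f x T.≈ f y → x S.≈ y) → n ≤ m → ∀ t → ∃ λ s → f s T.≈ t
  injection⇒surjection f inj n≤m t with any? (λ i → J.to (f (I.from i)) ≟ᶠ J.to t)
  ... | yes (i , eq) = I.from i , J.to-injective eq
  ... | no missed = contradiction n≤m (<⇒≱ (injective⇒≤ {f = g} g-inj))
    where
    g : Fin (suc m) → Fin n
    g = J.to t ∷ (J.to ∘ f ∘ I.from)
    g-inj : ∀ {i j} → g i ≡ g j → i ≡ j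
    g-inj {zero}  {zero}  _  = ≡.refl
    g-inj {zero}  {suc j} eq = contradiction (j , ≡.sym eq) missed
    g-inj {suc i} {zero}  eq = contradiction (i , eq) missed
    g-inj {suc i} {suc j} eq = ≡.cong suc (I.from-injective (inj (J.to-injective eq)))

  collision : (f : T.Carrier → S.Carrier) → m < n →
    ∃ λ x → ∃ λ y → ¬ x T.≈ y × f x S.≈ f y
  collision f m<n with any? (λ i → any? (λ j → dec i j))
    where
    dec : ∀ i j → Dec (¬ J.from i T.≈ J.from j × f (J.from i) S.≈ f (J.from j))
    dec i j = ¬? (J.from i J.≈? J.from j) ×-dec (f (J.from i) I.≈? f (J.from j))
  ... | yes (i , j , c) = J.from i , J.from j , c
  ... | no none = contradiction (injective⇒≤ {f = I.to ∘ f ∘ J.from}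
      (λ {i} {j} eq → decidable-stable (i ≟ᶠ j)
        (λ i≢j → none (i , j , (λ e → i≢j (J.from-injective e)) , I.to-injective eq))))
      (<⇒≱ m<n)

cardinality-unique : ∀ {S : Setoid α ℓ} {m n} → HasCardinality S m → HasCardinality S n → m ≡ n
cardinality-unique I J =
  ≤-antisym (injection⇒≤ I J (λ x → x) (λ e → e)) (injection⇒≤ J I (λ x → x) (λ e → e))

module _ {S : Setoid α ℓ₁} {T : Setoid β ℓ₂} where
  private
    module S = Setoid S
    module T = Setoid T

  bijection-cardinality : ∀ {n} → HasCardinality S n → (f : S.Carrier → T.Carrier) →
    (∀ {x y} → x S.≈ y → f x T.≈ f y) → (∀ {x y} → f x T.≈ f y → x S.≈ y) →
    (∀ t → ∃ λ s → f s T.≈ t) → HasCardinality T n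
  bijection-cardinality I f cong inj surj = enumeration⇒cardinality T (f ∘ from)
    (λ eq → from-injective (inj eq))
    (λ t → let s , eq = surj t in to s , T.trans (cong (from-to s)) eq)
    where open Finite I

≋-cardinality : {S : Setoid α ℓ} {q : ℕ} → HasCardinality S q →
  ∀ n → HasCardinality (≋-setoid S n) (q ^ n)
≋-cardinality {S = S} {q} I n = enumeration⇒cardinality (≋-setoid S n)
  (λ k i → from (finToFun k i))
  (λ {k} {l} eq → ≡.trans (≡.sym (funToFin-finToFin {n} {q} k))
    (≡.trans (funToFin-cong (λ i → from-injective (eq i))) (funToFin-finToFin {n} {q} l)))
  (λ x → funToFin (to ∘ x) , λ i → Setoid.trans S
    (Setoid.reflexive S (≡.cong from (finToFun-funToFin (to ∘ x) i))) (from-to (x i)))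
  where
  open Finite I
  funToFin-cong : ∀ {n} {f g : Fin n → Fin q} → (∀ i → f i ≡ g i) → funToFin f ≡ funToFin g
  funToFin-cong {zero}  eq = ≡.refl
  funToFin-cong {suc n} eq = ≡.cong₂ combine (eq zero) (funToFin-cong (eq ∘ suc))

-- The enumeration may repeat itself. `thin` drops an index when its value recurs among the later
-- indices that are kept; this requires deciding equality of enumerated elements only.
finite-image : {X : Setoid α ℓ} → let open Setoid X in
  ∀ {M} (e : Fin M → Carrier) → (∀ i j → Dec (e i ≈ e j)) →
  (∀ x → ∃ λ i → e i ≈ x) → ∃ (HasCardinality X)
finite-image {X = X} {M} e dec surj =
  let n , g , inj , hits = thin e dec
  in  n , enumeration⇒cardinality X (e ∘ g) inj
        (λ x → let i , eq = surj x ; j , eq′ = hits i in j , trans eq′ eq)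
  where
  open Setoid X
  thin : ∀ {M} (e : Fin M → Carrier) → (∀ i j → Dec (e i ≈ e j)) →
    ∃ λ n → ∃ λ (g : Fin n → Fin M) →
      (∀ {i j} → e (g i) ≈ e (g j) → i ≡ j) × (∀ i → ∃ λ j → e (g j) ≈ e i)
  thin {zero}  e dec = 0 , (λ ()) , (λ {}) , λ ()
  thin {suc M} e dec with thin (e ∘ suc) (λ i j → dec (suc i) (suc j))
  ... | n , g , inj , hits with any? (λ j → dec (suc (g j)) zero)
  ...   | yes h = n , suc ∘ g , inj , λ { zero → h ; (suc i) → hits i }
  ...   | no ¬h = suc n , zero ∷ (suc ∘ g) , inj′ ,
                  λ { zero → zero , refl ; (suc i) → let j , eq = hits i in suc j , eq }
    where
    g′ : Fin (suc n) → Fin (suc M)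
    g′ = zero ∷ (suc ∘ g)
    inj′ : ∀ {i j} → e (g′ i) ≈ e (g′ j) → i ≡ j
    inj′ {zero}  {zero}  eq = ≡.refl
    inj′ {zero}  {suc j} eq = contradiction (j , sym eq) ¬h
    inj′ {suc i} {zero}  eq = contradiction (i , eq) ¬h
    inj′ {suc i} {suc j} eq = ≡.cong suc (inj eq)

module _ {S : Setoid α ℓ₁} {D : Setoid γ ℓ₂} {X : Setoid β ℓ₃} {s k : ℕ} where
  private
    module S = Setoid S
    module D = Setoid D
    module X = Setoid X

  -- φ exhibits X as the set of orbits of a free action of D on S.
  orbits-cardinality : HasCardinality S s → HasCardinality D k →
    (φ : S.Carrier → X.Carrier) → (∀ x → ∃ λ y → φ y X.≈ x) →
    (_·_ : D.Carrier → S.Carrier → S.Carrier) →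
    (∀ {c c′} {x} → c D.≈ c′ → (c · x) S.≈ (c′ · x)) →
    (∀ {c c′ x} → (c · x) S.≈ (c′ · x) → c D.≈ c′) →
    (∀ {x y} → x S.≈ y → φ x X.≈ φ y) →
    (∀ c x → φ (c · x) X.≈ φ x) →
    (∀ {x y} → φ x X.≈ φ y → ∃ λ c → (c · x) S.≈ y) →
    HasCardinalityRatio X s k
  orbits-cardinality I J φ φ-surj _·_ ·-cong free φ-cong invariant orbit =
    divides n s≡nk , XI
    where
    module I = Finite I
    module J = Finite J
    -- Equality in `X` is not given as decidable: it is decided by searching the finite `D` for an
    -- element that carries `x` to `y`.
    same? : ∀ x y → Dec (φ x X.≈ φ y)
    same? x y = map′ (λ (c , eq) → X.trans (X.sym (invariant c x)) (φ-cong eq)) orbit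
      (J.any-element? (λ c≈c′ eq → S.trans (S.sym (·-cong c≈c′)) eq) (λ c → (c · x) I.≈? y))
    image : ∃ (HasCardinality X)
    image = finite-image {X = X} (φ ∘ I.from) (λ i j → same? (I.from i) (I.from j))
      (λ x → let y , eq = φ-surj x in I.to y , X.trans (φ-cong (I.from-to y)) eq)
    n = proj₁ image
    XI = proj₂ image
    module XI = Finite XI
    rep : Fin n → S.Carrier
    rep j = proj₁ (φ-surj (XI.from j))
    φ-rep : ∀ j → φ (rep j) X.≈ XI.from j
    φ-rep j = proj₂ (φ-surj (XI.from j))
    -- One representative per orbit, moved by all of `D`: freeness makes this injective,
    -- transitivity on orbits makes it onto, so `s` is `n` times `k`.
    f : Fin n × Fin k → S.Carrier
    f (j , c) = J.from c · rep j
    φ-f : ∀ jc → φ (f jc) X.≈ XI.from (proj₁ jc)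
    φ-f (j , c) = X.trans (invariant _ _) (φ-rep j)
    f-inj : ∀ {u v} → f u S.≈ f v → u ≡ v
    f-inj {u} {v} eq with XI.from-injective (X.trans (X.sym (φ-f u)) (X.trans (φ-cong eq) (φ-f v)))
    ... | ≡.refl = ≡.cong (proj₁ u ,_) (J.from-injective (free eq))
    f-surj : ∀ y → ∃ λ u → f u S.≈ y
    f-surj y with orbit {rep (XI.to (φ y))} {y} (X.trans (φ-rep _) (XI.from-to _))
    ... | c , eq = (XI.to (φ y) , J.to c) , S.trans (·-cong (J.from-to c)) eq
    nk : HasCardinality S (n ℕ.* k)
    nk = enumeration⇒cardinality S (f ∘ remQuot {n} k)
      (λ {i} {j} eq → ≡.trans (≡.sym (combine-remQuot {n} k i))
         (≡.trans (≡.cong (uncurry combine) (f-inj eq)) (combine-remQuot {n} k j)))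
      (λ y → let (j , c) , eq = f-surj y in combine j c ,
         S.trans (S.reflexive (≡.cong f (remQuot-combine j c))) eq)
    s≡nk : s ≡ n ℕ.* k
    s≡nk = cardinality-unique {S = S} I nk

-- Membership in finite subsets and the size of a difference.

module _ {L : Setoid α ℓ} (_≟ᴸ_ : Decidable (Setoid._≈_ L)) where
  open Setoid L

  ∈-dec : ∀ {A : Pred Carrier ρ} {n} → A Respects _≈_ →
    HasCardinality (Restrict L A) n → U.Decidable A
  ∈-dec resp I x = map′ (λ (i , eq) → resp eq (proj₂ (from i)))
    (λ x∈A → to (x , x∈A) , from-to (x , x∈A)) (any? (λ i → proj₁ (from i) ≟ᴸ x))
    where open Finite I

  module _ {A : Pred Carrier ℓ₁} {B : Pred Carrier ℓ₂} {m n : ℕ}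
           (A-resp : A Respects _≈_) (B-resp : B Respects _≈_)
           (I : HasCardinality (Restrict L A) m) (J : HasCardinality (Restrict L B) n)
           where
    private
      module I = Finite I
      module J = Finite J
      B? = ∈-dec B-resp J
      A∖B : Pred Carrier _
      A∖B x = A x × ¬ B x

    difference-finite : ∃ (HasCardinality (Restrict L A∖B))
    difference-finite with any? (λ i → ¬? (B? (proj₁ (I.from i))))
    ... | no none = finite-image {X = Restrict L A∖B} {0} (λ ()) (λ ())
      (λ (x , x∈A , x∉B) → contradiction
        (I.to (x , x∈A) , λ b → x∉B (B-resp (I.from-to (x , x∈A)) b)) none)
    ... | yes (i₀ , i₀∉B) = finite-image {X = Restrict L A∖B} e
      (λ i j → proj₁ (e i) ≟ᴸ proj₁ (e j)) surj
      where
      -- Elements of `B` are redirected to the fixed element `i₀` outside `B`, so that the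
      -- enumeration of `A` becomes one of the difference, with repetitions.
      choose : ∀ i → Dec (B (proj₁ (I.from i))) → Σ Carrier A∖B
      choose i (yes _)  = proj₁ (I.from i₀) , proj₂ (I.from i₀) , i₀∉B
      choose i (no i∉B) = proj₁ (I.from i) , proj₂ (I.from i) , i∉B
      e : Fin m → Σ Carrier A∖B
      e i = choose i (B? (proj₁ (I.from i)))
      surj : ∀ x → ∃ λ i → proj₁ (e i) ≈ proj₁ x
      surj (x , x∈A , x∉B) = i , chosen (B? _)
        where
        i = I.to (x , x∈A)
        chosen : ∀ d → proj₁ (choose i d) ≈ x
        chosen (yes b) = contradiction (B-resp (I.from-to (x , x∈A)) b) x∉B
        chosen (no _)  = I.from-to (x , x∈A)

    difference-cardinality : B ⊆ A → HasCardinality (Restrict L A∖B) (m ∸ n)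
    difference-cardinality B⊆A = ≡.subst (HasCardinality (Restrict L A∖B)) k≡m∸n K
      where
      k = proj₁ difference-finite
      K = proj₂ difference-finite
      module K = Finite K
      f : Fin k ⊎ Fin n → Σ Carrier A
      f (inj₁ i) = map₂ proj₁ (K.from i)
      f (inj₂ j) = map₂ B⊆A (J.from j)
      f-inj : ∀ {u v} → proj₁ (f u) ≈ proj₁ (f v) → u ≡ v
      f-inj {inj₁ i} {inj₁ j} eq = ≡.cong inj₁ (K.from-injective eq)
      f-inj {inj₁ i} {inj₂ j} eq =
        contradiction (B-resp (sym eq) (proj₂ (J.from j))) (proj₂ (proj₂ (K.from i)))
      f-inj {inj₂ i} {inj₁ j} eq =
        contradiction (B-resp eq (proj₂ (J.from i))) (proj₂ (proj₂ (K.from j)))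
      f-inj {inj₂ i} {inj₂ j} eq = ≡.cong inj₂ (J.from-injective eq)
      f-surj : ∀ x → ∃ λ u → proj₁ (f u) ≈ proj₁ x
      f-surj (x , x∈A) with B? x
      ... | yes x∈B = inj₂ (J.to (x , x∈B)) , J.from-to _
      ... | no  x∉B = inj₁ (K.to (x , x∈A , x∉B)) , K.from-to _
      -- The two enumerations glue to one of `A`, whence `k + n` equals `m` and the truncated
      -- subtraction is exact.
      k+n : HasCardinality (Restrict L A) (k ℕ.+ n)
      k+n = enumeration⇒cardinality (Restrict L A) (f ∘ splitAt k)
        (λ {i} {j} eq → ≡.trans (≡.sym (join-splitAt k n i))
           (≡.trans (≡.cong (join k n) (f-inj {splitAt k i} {splitAt k j} eq))
             (join-splitAt k n j)))
        (λ x → let u , eq = f-surj x in join k n u ,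
           trans (reflexive (≡.cong (proj₁ ∘ f) (splitAt-join k n u))) eq)
      k≡m∸n : k ≡ m ∸ n
      k≡m∸n = ≡.trans (≡.sym (m+n∸n≡m k n))
        (≡.cong (_∸ n) (cardinality-unique {S = Restrict L A} k+n I))

-- Finite fields: inverses, roots of polynomials, Fermat's theorem, subfields.

module FiniteField {c ℓ₁ ℓ₂} (𝕃 : HeytingField c ℓ₁ ℓ₂)
                   {M : ℕ} (𝕃-finite : HasCardinality (fieldSetoid 𝕃) M) where
  private module 𝕃 = HeytingField 𝕃
  open CommutativeRing (HeytingCommutativeRing.commutativeRing 𝕃.heytingCommutativeRing) hiding (zero)
  open Exp semiring using (^-congˡ; ^-assocʳ) renaming (_^_ to _^ᴸ_)
  open RingProperties ring using (x∙y⁻¹≈ε⇒x≈y; -1*x≈-x; -0#≈0#)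
  open SemiringSolver commutativeSemiring using (solve; _:=_; _:+_; _:*_)
  open Finite 𝕃-finite renaming (_≈?_ to _≟_)
  open ≈-Reasoning setoid

  private
    variable
      m n : ℕ

  1≉0 : ¬ 1# ≈ 0#
  1≉0 1≈0 = proj₂ (𝕃.tight 1# 0#) 1≈0
    (𝕃.invertible⇒# (1# , 1*[1-0]≈1 , trans (*-comm _ _) 1*[1-0]≈1))
    where
    1*[1-0]≈1 : 1# * (1# - 0#) ≈ 1#
    1*[1-0]≈1 = trans (*-identityˡ _) (trans (+-congˡ -0#≈0#) (+-identityʳ 1#))

  -- The field axioms give inverses only to elements apart from zero, and `x≉0` yields apartness
  -- only up to double negation. Since a finite search decides whether an inverse exists, the double
  -- negation can be removed.
  inverse : ∀ {x} → ¬ x ≈ 0# → ∃ λ y → x * y ≈ 1#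
  inverse {x} x≉0 = decidable-stable
    (any-element? (λ y≈z eq → trans (*-congˡ (sym y≈z)) eq) (λ y → (x * y) ≟ 1#))
    λ no-inverse → x≉0 (proj₁ (𝕃.tight x 0#) λ x#0 →
      let y , _ , eq = 𝕃.#⇒invertible x#0
      in no-inverse (y , trans (*-congʳ (sym (trans (+-congˡ -0#≈0#) (+-identityʳ x)))) eq))

  xy≈1⇒y≉0 : ∀ {x y} → x * y ≈ 1# → ¬ y ≈ 0#
  xy≈1⇒y≉0 xy≈1 y≈0 = 1≉0 (trans (sym xy≈1) (trans (*-congˡ y≈0) (zeroʳ _)))

  cancel-inverse : ∀ {x y} → x * y ≈ 1# → ∀ z → x * (y * z) ≈ z
  cancel-inverse xy≈1 z = trans (sym (*-assoc _ _ _)) (trans (*-congʳ xy≈1) (*-identityˡ z))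

  cancel-inverse′ : ∀ {x y} → x * y ≈ 1# → ∀ z → y * (x * z) ≈ z
  cancel-inverse′ xy≈1 = cancel-inverse (trans (*-comm _ _) xy≈1)

  *-cancelˡ-≉0 : ∀ {x y z} → ¬ x ≈ 0# → x * y ≈ x * z → y ≈ z
  *-cancelˡ-≉0 x≉0 eq = let _ , xx′≈1 = inverse x≉0 in
    trans (sym (cancel-inverse′ xx′≈1 _)) (trans (*-congˡ eq) (cancel-inverse′ xx′≈1 _))

  xy≈0⇒y≈0 : ∀ {x y} → ¬ x ≈ 0# → x * y ≈ 0# → y ≈ 0#
  xy≈0⇒y≈0 x≉0 eq = *-cancelˡ-≉0 x≉0 (trans eq (sym (zeroʳ _)))

  *-≉0 : ∀ {x y} → ¬ x ≈ 0# → ¬ y ≈ 0# → ¬ x * y ≈ 0#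
  *-≉0 x≉0 y≉0 xy≈0 = y≉0 (xy≈0⇒y≈0 x≉0 xy≈0)

  x-y≈0⇒x≈y : ∀ {x y} → x - y ≈ 0# → x ≈ y
  x-y≈0⇒x≈y = x∙y⁻¹≈ε⇒x≈y _ _

  x-y+y≈x : ∀ x y → (x - y) + y ≈ x
  x-y+y≈x x y = trans (+-assoc _ _ _) (trans (+-congˡ (-‿inverseˡ y)) (+-identityʳ x))

  -- Monic polynomial functions, in Horner form.
  Monic : ℕ → (Carrier → Carrier) → Set _
  Monic zero    f = ∀ x → f x ≈ 1#
  Monic (suc n) f = ∃ λ g → ∃ λ b → Monic n g × (∀ x → f x ≈ x * g x + b)

  -- Synthetic division: if `g` has quotient `h` and remainder `g a`, then `x * g x + b` has
  -- quotient `x * h x + g a`.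
  divide-by-root : ∀ {f} → Monic (suc n) f → ∀ a →
    ∃ λ h → Monic n h × (∀ x → f x ≈ (x - a) * h x + f a)
  divide-by-root {zero} {f} (g , b , g≈1 , f≈) a = (λ _ → 1#) , (λ _ → refl) , λ x → begin
    f x                      ≈⟨ f≈1 x ⟩
    x + b                    ≈⟨ +-congʳ (x-y+y≈x x a) ⟨
    (x - a) + a + b          ≈⟨ +-assoc _ _ _ ⟩
    (x - a) + (a + b)        ≈⟨ +-cong (*-identityʳ _) (f≈1 a) ⟨
    (x - a) * 1# + f a       ∎
    where
    f≈1 : ∀ x → f x ≈ x + b
    f≈1 x = trans (f≈ x) (+-congʳ (trans (*-congˡ (g≈1 x)) (*-identityʳ x)))
  divide-by-root {suc n} {f} (g , b , g-monic , f≈) a with divide-by-root {n} g-monic a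
  ... | h , h-monic , g≈ = (λ x → x * h x + g a) , (h , g a , h-monic , λ _ → refl) , λ x → begin
    f x                                             ≈⟨ f≈ x ⟩
    x * g x + b                                     ≈⟨ +-congʳ (*-congˡ (g≈ x)) ⟩
    x * ((x - a) * h x + g a) + b                   ≈⟨ +-congʳ (distribˡ _ _ _) ⟩
    x * ((x - a) * h x) + x * g a + b               ≈⟨ +-congʳ (+-congˡ (*-congʳ (x-y+y≈x x a))) ⟨
    x * ((x - a) * h x) + ((x - a) + a) * g a + b
      ≈⟨ solve 6 (λ x y a h g b → x :* (y :* h) :+ (y :+ a) :* g :+ b
                   := y :* (x :* h :+ g) :+ (a :* g :+ b)) refl x (x - a) a (h x) (g a) b ⟩
    (x - a) * (x * h x + g a) + (a * g a + b)       ≈⟨ +-congˡ (f≈ a) ⟨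
    (x - a) * (x * h x + g a) + f a                 ∎

  -- Splitting off the root `r zero` lowers the degree; each other root differs from it and hence,
  -- without zero divisors, is a root of the quotient. In degree zero `1# ≈ 0#` remains.
  monic-roots : ∀ {f} → Monic n f → (r : Fin (suc n) → Carrier) →
    (∀ {i j} → r i ≈ r j → i ≡ j) → ¬ (∀ i → f (r i) ≈ 0#)
  monic-roots {zero}  f≈1 r inj roots = 1≉0 (trans (sym (f≈1 _)) (roots zero))
  monic-roots {suc n} {f} f-monic r inj roots with divide-by-root {n} f-monic (r zero)
  ... | h , h-monic , f≈ = monic-roots {n} h-monic (r ∘ suc) (suc-injective ∘ inj) λ i →
    xy≈0⇒y≈0 (λ d≈0 → case inj (x-y≈0⇒x≈y d≈0) of λ ()) (begin
      (r (suc i) - r zero) * h (r (suc i))               ≈⟨ +-identityʳ _ ⟨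
      (r (suc i) - r zero) * h (r (suc i)) + 0#          ≈⟨ +-congˡ (roots zero) ⟨
      (r (suc i) - r zero) * h (r (suc i)) + f (r zero)  ≈⟨ f≈ _ ⟨
      f (r (suc i))                                      ≈⟨ roots (suc i) ⟩
      0#                                                 ∎)

  x^n-monic : ∀ n → Monic n (_^ᴸ n)
  x^n-monic zero    x = refl
  x^n-monic (suc n) = (_^ᴸ n) , 0# , x^n-monic n , λ x → sym (+-identityʳ _)

  -- The bound keeps the subtracted `x` below the leading term.
  x^n-x-monic : 2 ≤ n → Monic n (λ x → x ^ᴸ n - x)
  x^n-x-monic {suc (suc n)} (s≤s (s≤s z≤n)) =
    (λ x → x * x ^ᴸ n + - 1#) , 0# , ((_^ᴸ n) , - 1# , x^n-monic n , λ _ → refl) , λ x → begin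
      x * (x * x ^ᴸ n) - x                     ≈⟨ +-congˡ (trans (*-comm x _) (-1*x≈-x x)) ⟨
      x * (x * x ^ᴸ n) + x * (- 1#)            ≈⟨ distribˡ _ _ _ ⟨
      x * (x * x ^ᴸ n + - 1#)                  ≈⟨ +-identityʳ _ ⟨
      x * (x * x ^ᴸ n + - 1#) + 0#             ∎

  module _ {U : Subset 𝕃} (U-subfield : IsSubfield 𝕃 U)
           (U-finite : HasCardinality (Restrict setoid U) n) where
    open IsSubfield U-subfield

    U∖0 : Subset 𝕃
    U∖0 x = x ∈ U × ¬ x ≈ 0#

    subfield∖0-cardinality : HasCardinality (Restrict setoid U∖0) (n ∸ 1)
    subfield∖0-cardinality = difference-cardinality _≟_ {B = _≈ 0#} resp (λ x≈y → trans (sym x≈y))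
      U-finite
      (enumeration⇒cardinality (Restrict setoid (_≈ 0#)) {1} (λ _ → 0# , refl)
        (λ { {zero} {zero} _ → ≡.refl }) (λ (x , x≈0) → zero , sym x≈0))
      (λ x≈0 → resp (sym x≈0) 0∈)

    2≤cardinality : 2 ≤ n
    2≤cardinality = injective⇒≤ {f = λ i → Finite.to U-finite (bit i)}
      (λ {i} {j} eq → bit-injective i j (Finite.to-injective U-finite eq))
      where
      bit : Fin 2 → Σ Carrier U
      bit zero    = 0# , 0∈
      bit (suc _) = 1# , 1∈
      bit-injective : ∀ i j → proj₁ (bit i) ≈ proj₁ (bit j) → i ≡ j
      bit-injective zero       zero       _  = ≡.refl
      bit-injective zero       (suc zero) eq = contradiction (sym eq) 1≉0
      bit-injective (suc zero) zero       eq = contradiction eq 1≉0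
      bit-injective (suc zero) (suc zero) _  = ≡.refl

    -- Multiplication by x permutes the nonzero elements, so their product absorbs x ^ᴸ (n ∸ 1).
    fermat-≉0 : ∀ {x} → x ∈ U → ¬ x ≈ 0# → x ^ᴸ (n ∸ 1) ≈ 1#
    fermat-≉0 {x} x∈U x≉0 = *-cancelˡ-≉0 (∏≉0 elements (proj₂ ∘ proj₂ ∘ from*)) (begin
      ∏ elements * x ^ᴸ (n ∸ 1)               ≈⟨ *-comm _ _ ⟩
      x ^ᴸ (n ∸ 1) * ∏ elements               ≈⟨ *-congʳ (∏-replicate (n ∸ 1)) ⟨
      ∏ {n ∸ 1} (λ _ → x) * ∏ elements        ≈⟨ ∏-distrib (λ _ → x) elements ⟨
      ∏ (λ i → x * elements i)
        ≈⟨ ∏-cong (λ i → sym (from-to* (times x∈U x≉0 (from* i)))) ⟩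
      ∏ (λ i → elements (to* (times x∈U x≉0 (from* i))))
        ≈⟨ ∏-permute elements π ⟨
      ∏ elements                              ≈⟨ *-identityʳ _ ⟨
      ∏ elements * 1#                         ∎)
      where
      open Sum *-commutativeMonoid using ()
        renaming (sum to ∏; ∑-distrib-+ to ∏-distrib; sum-replicate to ∏-replicate;
                  sum-cong-≋ to ∏-cong; sum-permute to ∏-permute)
      open Finite subfield∖0-cardinality using ()
        renaming (from to from*; to to to*; from-to to from-to*; from-injective to from*-injective)
      elements : Fin (n ∸ 1) → Carrier
      elements = proj₁ ∘ from*
      ∏≉0 : ∀ {n} (f : Fin n → Carrier) → (∀ i → ¬ f i ≈ 0#) → ¬ ∏ f ≈ 0#
      ∏≉0 {zero}  f f≉0 = 1≉0
      ∏≉0 {suc n} f f≉0 = *-≉0 (f≉0 zero) (∏≉0 (f ∘ suc) (f≉0 ∘ suc))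
      times : ∀ {y} → y ∈ U → ¬ y ≈ 0# → Σ Carrier U∖0 → Σ Carrier U∖0
      times {y} y∈U y≉0 (z , z∈U , z≉0) = y * z , *-closed y∈U z∈U , *-≉0 y≉0 z≉0
      x⁻¹ = proj₁ (inverse x≉0)
      xx⁻¹≈1 = proj₂ (inverse x≉0)
      x⁻¹∈U : x⁻¹ ∈ U
      x⁻¹∈U = inv-closed x∈U xx⁻¹≈1
      x⁻¹≉0 : ¬ x⁻¹ ≈ 0#
      x⁻¹≉0 = xy≈1⇒y≉0 xx⁻¹≈1
      π : Permutation′ (n ∸ 1)
      π = permutation (λ i → to* (times x∈U x≉0 (from* i))) (λ i → to* (times x⁻¹∈U x⁻¹≉0 (from* i)))
        (λ i → from*-injective
          (trans (from-to* _) (trans (*-congˡ (from-to* _)) (cancel-inverse xx⁻¹≈1 _))))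
        (λ i → from*-injective
          (trans (from-to* _) (trans (*-congˡ (from-to* _)) (cancel-inverse′ xx⁻¹≈1 _))))

    fermat : ∀ {x} → x ∈ U → x ^ᴸ n ≈ x
    fermat {x} x∈U with x ≟ 0#
    ... | yes x≈0 = 0^n≈0 2≤cardinality
      where
      0^n≈0 : ∀ {n} → 2 ≤ n → x ^ᴸ n ≈ x
      0^n≈0 (s≤s _) = trans (*-congʳ x≈0) (trans (zeroˡ _) (sym x≈0))
    ... | no x≉0 = x^n≈x 2≤cardinality (fermat-≉0 x∈U x≉0)
      where
      x^n≈x : ∀ {n} → 2 ≤ n → x ^ᴸ (n ∸ 1) ≈ 1# → x ^ᴸ n ≈ x
      x^n≈x (s≤s _) eq = trans (*-congˡ eq) (*-identityʳ x)

    -- Applied to `F`, this makes its elements satisfy the equation of degree `n ^ k` that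
    -- characterises the larger field `E`.
    fermat-iterate : ∀ {x} → x ∈ U → ∀ k → x ^ᴸ (n ^ k) ≈ x
    fermat-iterate x∈U zero    = *-identityʳ _
    fermat-iterate {x} x∈U (suc k) = begin
      x ^ᴸ (n ℕ.* n ^ k)   ≈⟨ ^-assocʳ x n _ ⟨
      (x ^ᴸ n) ^ᴸ (n ^ k)   ≈⟨ ^-congˡ (n ^ k) (fermat x∈U) ⟩
      x ^ᴸ (n ^ k)         ≈⟨ fermat-iterate x∈U k ⟩
      x                     ∎

  -- E consists of all the roots of X ^ (n ^ k) - X, among which are the elements of F.
  subfield-inclusion : ∀ {F E : Subset 𝕃} {k} →
    IsSubfield 𝕃 F → HasCardinality (Restrict setoid F) n →
    IsSubfield 𝕃 E → HasCardinality (Restrict setoid E) (n ^ k) → F ⊆ E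
  subfield-inclusion {n} {F} {E} {k} F-sub F-fin E-sub E-fin {x} x∈F =
    decidable-stable (∈-dec _≟_ {A = E} (IsSubfield.resp E-sub) E-fin x) λ x∉E →
      monic-roots (x^n-x-monic (2≤cardinality E-sub E-fin)) (roots x∉E) (inj x∉E) (is-root x∉E)
    where
    open Finite E-fin using () renaming (from to fromᴱ; from-injective to fromᴱ-injective)
    -- An `x` outside `E` would join the elements of `E` as one root more than the degree allows.
    roots : x ∉ E → Fin (suc (n ^ k)) → Carrier
    roots _ = x ∷ (proj₁ ∘ fromᴱ)
    inj : ∀ x∉E {i j} → roots x∉E i ≈ roots x∉E j → i ≡ j
    inj x∉E {zero}  {zero}  _  = ≡.refl
    inj x∉E {zero}  {suc j} eq = contradiction (IsSubfield.resp E-sub (sym eq) (proj₂ (fromᴱ j))) x∉E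
    inj x∉E {suc i} {zero}  eq = contradiction (IsSubfield.resp E-sub eq (proj₂ (fromᴱ i))) x∉E
    inj x∉E {suc i} {suc j} eq = ≡.cong suc (fromᴱ-injective eq)
    is-root : ∀ x∉E i → (let y = roots x∉E i in y ^ᴸ (n ^ k) - y) ≈ 0#
    is-root x∉E zero    = trans (+-congʳ (fermat-iterate F-sub F-fin x∈F k)) (-‿inverseʳ _)
    is-root x∉E (suc i) = trans (+-congʳ (fermat E-sub E-fin (proj₂ (fromᴱ i)))) (-‿inverseʳ _)

-- Linear algebra over `F` by counting.

module LinearAlgebra {c ℓ₁ ℓ₂} (𝕃 : HeytingField c ℓ₁ ℓ₂)
                     {M : ℕ} (𝕃-finite : HasCardinality (fieldSetoid 𝕃) M)
                     {F : Subset 𝕃} (F-subfield : IsSubfield 𝕃 F)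
                     {q : ℕ} (F-finite : HasCardinality (Restrict (fieldSetoid 𝕃) F) q) where
  private module 𝕃 = HeytingField 𝕃
  open CommutativeRing (HeytingCommutativeRing.commutativeRing 𝕃.heytingCommutativeRing) hiding (zero)
  open SemiringSum semiring using (sum-cong-≋; *-distribˡ-sum; ∑-distrib-+; sum-replicate-zero)
  open RingProperties ring using (-1*x≈-x; +-inverseˡ-unique)
  open SemiringSolver commutativeSemiring using (solve; _:=_; _:*_)
  open Finite 𝕃-finite using () renaming (_≈?_ to _≟_)
  open FiniteField 𝕃 𝕃-finite
  open ≈-Reasoning setoid
  module F = IsSubfield F-subfield

  private
    variable
      m n d : ℕ

  Coefficients : ℕ → Setoid _ _
  Coefficients = ≋-setoid (Restrict setoid F)

  infix 7 _∙_
  _∙_ : Vector Carrier n → Vector Carrier n → Carrier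
  _∙_ = combination 𝕃 F

  Span : Vector Carrier n → Subset 𝕃
  Span v x = ∃ λ s → (∀ i → s i ∈ F) × x ≈ s ∙ v

  Independent : Vector Carrier n → Set _
  Independent v = ∀ s → (∀ i → s i ∈ F) → s ∙ v ≈ 0# → ∀ i → s i ≈ 0#

  ∙-congʳ : ∀ {s t : Vector Carrier n} v → (∀ i → s i ≈ t i) → s ∙ v ≈ t ∙ v
  ∙-congʳ v s≈t = sum-cong-≋ (λ i → *-congʳ (s≈t i))

  ∙-+ : ∀ (s t v : Vector Carrier n) → (λ i → s i + t i) ∙ v ≈ s ∙ v + t ∙ v
  ∙-+ s t v = trans (sum-cong-≋ (λ i → distribʳ (v i) (s i) (t i)))
    (∑-distrib-+ (λ i → s i * v i) (λ i → t i * v i))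

  ∙-*ˡ : ∀ a (s v : Vector Carrier n) → (λ i → a * s i) ∙ v ≈ a * (s ∙ v)
  ∙-*ˡ a s v = trans (sum-cong-≋ (λ i → *-assoc a (s i) (v i)))
    (sym (*-distribˡ-sum a (λ i → s i * v i)))

  ∙-*ʳ : ∀ a (s v : Vector Carrier n) → s ∙ (λ i → a * v i) ≈ a * (s ∙ v)
  ∙-*ʳ a s v = trans
    (sum-cong-≋ (λ i → solve 3 (λ a s v → s :* (a :* v) := a :* (s :* v)) refl a (s i) (v i)))
    (sym (*-distribˡ-sum a (λ i → s i * v i)))

  0∙ : ∀ (v : Vector Carrier n) → (λ _ → 0#) ∙ v ≈ 0#
  0∙ {n} v = trans (sum-cong-≋ (λ i → zeroˡ (v i))) (sum-replicate-zero n)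

  module Subspace {U : Subset 𝕃} (U-subspace : IsSubspace 𝕃 F U) where
    open IsSubspace U-subspace public

    -‿closed : ∀ {x y} → x ∈ U → y ∈ U → x - y ∈ U
    -‿closed x∈U y∈U = +-closed x∈U (resp (-1*x≈-x _) (*-closed (F.-‿closed F.1∈) y∈U))

    span-closed : (v : Vector Carrier n) → (∀ i → v i ∈ U) → Span v ⊆ U
    span-closed {zero}  v v∈U (s , s∈F , x≈) = resp (sym x≈) 0∈
    span-closed {suc n} v v∈U (s , s∈F , x≈) = resp (sym x≈) (+-closed (*-closed (s∈F zero) (v∈U zero))
      (span-closed (tail v) (v∈U ∘ suc) (tail s , s∈F ∘ suc , refl)))

    scalar-cancel : ∀ {f x} → f ∈ F → ¬ f ≈ 0# → f * x ∈ U → x ∈ U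
    scalar-cancel f∈F f≉0 fx∈U = let _ , ff′≈1 = inverse f≉0 in
      resp (cancel-inverse′ ff′≈1 _) (*-closed (F.inv-closed f∈F ff′≈1) fx∈U)

  span-isSubspace : (v : Vector Carrier n) → IsSubspace 𝕃 F (Span v)
  span-isSubspace v = record
    { resp     = λ x≈y (s , s∈F , x≈) → s , s∈F , trans (sym x≈y) x≈
    ; 0∈       = (λ _ → 0#) , (λ _ → F.0∈) , sym (0∙ v)
    ; +-closed = λ (s , s∈F , x≈) (t , t∈F , y≈) →
        (λ i → s i + t i) , (λ i → F.+-closed (s∈F i) (t∈F i)) , trans (+-cong x≈ y≈) (sym (∙-+ s t v))
    ; *-closed = λ {a} a∈F (s , s∈F , x≈) →
        (λ i → a * s i) , (λ i → F.*-closed a∈F (s∈F i)) , trans (*-congˡ x≈) (sym (∙-*ˡ a s v))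
    }

  span-tail : (v : Vector Carrier (suc n)) → Span (tail v) ⊆ Span v
  span-tail v (s , s∈F , x≈) = 0# ∷ s , (λ { zero → F.0∈ ; (suc i) → s∈F i }) ,
    trans x≈ (sym (trans (+-congʳ (zeroˡ _)) (+-identityˡ _)))

  generator∈span : (v : Vector Carrier n) → ∀ i → v i ∈ Span v
  generator∈span v zero = 1# ∷ (λ _ → 0#) , (λ { zero → F.1∈ ; (suc i) → F.0∈ }) ,
    sym (trans (+-cong (*-identityˡ _) (0∙ (tail v))) (+-identityʳ _))
  generator∈span v (suc i) = span-tail v (generator∈span (tail v) i)

  span-cardinality : (v : Vector Carrier n) → Independent v →
    HasCardinality (Restrict setoid (Span v)) (q ^ n)
  span-cardinality {n} v indep = bijection-cardinality {S = Coefficients n}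
    {T = Restrict setoid (Span v)} (≋-cardinality F-finite n)
    (λ s → (proj₁ ∘ s) ∙ v , proj₁ ∘ s , proj₂ ∘ s , refl)
    (λ s≈t → ∙-congʳ v s≈t)
    (λ {s} {t} eq i → x-y≈0⇒x≈y (indep (λ i → proj₁ (s i) - proj₁ (t i))
      (λ i → F.+-closed (proj₂ (s i)) (F.-‿closed (proj₂ (t i)))) (difference s t eq) i))
    (λ (x , s , s∈F , x≈) → (λ i → s i , s∈F i) , sym x≈)
    where
    difference : ∀ s t → (proj₁ ∘ s) ∙ v ≈ (proj₁ ∘ t) ∙ v → (λ i → proj₁ (s i) - proj₁ (t i)) ∙ v ≈ 0#
    difference s t eq = begin
      (λ i → proj₁ (s i) - proj₁ (t i)) ∙ v
        ≈⟨ ∙-+ (proj₁ ∘ s) (λ i → - proj₁ (t i)) v ⟩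
      (proj₁ ∘ s) ∙ v + (λ i → - proj₁ (t i)) ∙ v
        ≈⟨ +-cong eq (∙-congʳ v (λ i → sym (-1*x≈-x (proj₁ (t i))))) ⟩
      (proj₁ ∘ t) ∙ v + (λ i → - 1# * proj₁ (t i)) ∙ v
        ≈⟨ +-congˡ (trans (∙-*ˡ (- 1#) (proj₁ ∘ t) v) (-1*x≈-x _)) ⟩
      (proj₁ ∘ t) ∙ v - (proj₁ ∘ t) ∙ v
        ≈⟨ -‿inverseʳ _ ⟩
      0# ∎

  independent-∷ : ∀ {x} {v : Vector Carrier n} → Independent v → x ∉ Span v → Independent (x ∷ v)
  independent-∷ {n} {x} {v} indep x∉v s s∈F eq with s zero ≟ 0#
  ... | yes s₀≈0 = λ { zero → s₀≈0 ; (suc i) → indep (tail s) (s∈F ∘ suc) tail≈0 i }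
    where
    tail≈0 : tail s ∙ v ≈ 0#
    tail≈0 = trans (sym (trans (+-congʳ (trans (*-congʳ s₀≈0) (zeroˡ _))) (+-identityˡ _))) eq
  ... | no s₀≉0 = contradiction
    (scalar-cancel (s∈F zero) s₀≉0 (resp (sym (+-inverseˡ-unique _ _ eq))
      (resp (-1*x≈-x _) (*-closed (F.-‿closed F.1∈) (tail s , s∈F ∘ suc , refl))))) x∉v
    where open Subspace (span-isSubspace v)

  -- The inclusion map is an injection between sets of equal size, hence onto. This stands in for
  -- comparing dimensions.
  ⊆-cardinality⇒⊇ : ∀ {A B : Subset 𝕃} → A Respects _≈_ →
    HasCardinality (Restrict setoid A) n → HasCardinality (Restrict setoid B) n → A ⊆ B → B ⊆ A
  ⊆-cardinality⇒⊇ {A = A} {B} resp I J A⊆B {x} x∈B =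
    let (y , y∈A) , y≈x = injection⇒surjection {S = Restrict setoid A} {T = Restrict setoid B} I J
                            (map₂ A⊆B) (λ e → e) ≤-refl (x , x∈B)
    in resp y≈x y∈A

  module _ {a b} {A B : Subset 𝕃} (B-resp : B Respects _≈_)
           (I : HasCardinality (Restrict setoid A) a) (J : HasCardinality (Restrict setoid B) b) where
    private
      module I = Finite I
      B? = ∈-dec _≟_ {A = B} B-resp J

    larger⇒∃∉ : b < a → ∃ λ x → x ∈ A × x ∉ B
    larger⇒∃∉ b<a with any? (λ i → ¬? (B? (proj₁ (I.from i))))
    ... | yes (i , i∉B) = proj₁ (I.from i) , proj₂ (I.from i) , i∉B
    ... | no none = contradiction
      (injection⇒≤ {S = Restrict setoid A} {T = Restrict setoid B} I J
        (λ (x , x∈A) → x , A⊆B x∈A) (λ e → e))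
      (<⇒≱ b<a)
      where
      A⊆B : A ⊆ B
      A⊆B {x} x∈A = B-resp (I.from-to (x , x∈A))
        (decidable-stable (B? _) (λ x∉B → none (I.to (x , x∈A) , x∉B)))

  -- Counting replaces the exchange lemma: fewer than `d` independent vectors span fewer than
  -- `q ^ d` elements, so `U` has an element outside their span to adjoin.
  independent-extension : ∀ {U : Subset 𝕃} → HasCardinality (Restrict setoid U) (q ^ d) →
    n ≤ m → m ≤ d → (v : Vector Carrier n) → Independent v → (∀ i → v i ∈ U) →
    ∃ λ (w : Vector Carrier m) → Independent w × (∀ i → w i ∈ U) × Span v ⊆ Span w
  independent-extension {d} {n} {m} {U} U-finite n≤m m≤d v v-indep v∈U = extend (≤⇒≤′ n≤m) m≤d
    where
    extend : ∀ {m} → n ≤′ m → m ≤ d →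
      ∃ λ (w : Vector Carrier m) → Independent w × (∀ i → w i ∈ U) × Span v ⊆ Span w
    extend ≤′-refl _ = v , v-indep , v∈U , λ x → x
    extend (≤′-step {m} n≤m) m<d with extend n≤m (<⇒≤ m<d)
    ... | w , w-indep , w∈U , v⊆w = x ∷ w , independent-∷ w-indep x∉w ,
          (λ { zero → x∈U ; (suc i) → w∈U i }) , λ y∈v → span-tail (x ∷ w) (v⊆w y∈v)
      where
      outside : ∃ λ (x : Carrier) → x ∈ U × x ∉ Span w
      outside = larger⇒∃∉ {A = U} {Span w} (IsSubspace.resp (span-isSubspace w)) U-finite
        (span-cardinality w w-indep) (^-monoʳ-< q (2≤cardinality F-subfield F-finite) m<d)
      x = proj₁ outside
      x∈U = proj₁ (proj₂ outside)
      x∉w = proj₂ (proj₂ outside)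

-- Hyperplanes as multiples of one fixed hyperplane.

module Hyperplanes {c ℓ₁ ℓ₂} (𝕃 : HeytingField c ℓ₁ ℓ₂) {q m k : ℕ}
                   (𝕃-finite : HasCardinality (fieldSetoid 𝕃) (q ^ suc m))
                   {F : Subset 𝕃} (F-subfield : IsSubfield 𝕃 F)
                   (F-finite : HasCardinality (Restrict (fieldSetoid 𝕃) F) q)
                   {E : Subset 𝕃} (E-subfield : IsSubfield 𝕃 E)
                   (E-finite : HasCardinality (Restrict (fieldSetoid 𝕃) E) (q ^ k))
                   (1+m≡2k : suc m ≡ k ℕ.* 2) (k≤m : k ≤ m) where
  private module 𝕃 = HeytingField 𝕃
  open CommutativeRing (HeytingCommutativeRing.commutativeRing 𝕃.heytingCommutativeRing) hiding (zero)
  open RingProperties ring using (-‿distribˡ-*; -‿+-comm; xyx⁻¹≈y)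
  open SemiringSolver commutativeSemiring using (solve; _:=_; _:+_; _:*_)
  open Finite 𝕃-finite using () renaming (_≈?_ to _≟_)
  open FiniteField 𝕃 𝕃-finite
  open LinearAlgebra 𝕃 𝕃-finite F-subfield F-finite
  open ≈-Reasoning setoid
  module E = IsSubfield E-subfield

  cancel-right : ∀ {a x y} → x * y ≈ 1# → a * x * y ≈ a
  cancel-right {a} {x} {y} xy≈1 = trans (*-assoc a x y) (trans (*-congˡ xy≈1) (*-identityʳ a))

  x*[y*z]≈y*[x*z] : ∀ x y z → x * (y * z) ≈ y * (x * z)
  x*[y*z]≈y*[x*z] = solve 3 (λ x y z → x :* (y :* z) := y :* (x :* z)) refl

  x*[y*z]≈z*[x*y] : ∀ x y z → x * (y * z) ≈ z * (x * y)
  x*[y*z]≈z*[x*y] = solve 3 (λ x y z → x :* (y :* z) := z :* (x :* y)) refl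

  E-cancel : ∀ {e x} → e ∈ E → ¬ e ≈ 0# → e * x ∈ E → x ∈ E
  E-cancel e∈E e≉0 ex∈E = let _ , ed≈1 = inverse e≉0 in
    E.resp (cancel-inverse′ ed≈1 _) (E.*-closed (E.inv-closed e∈E ed≈1) ex∈E)

  F⊆E : F ⊆ E
  F⊆E = subfield-inclusion {k = k} F-subfield F-finite E-subfield E-finite

  E-isSubspace : IsSubspace 𝕃 F E
  E-isSubspace = record
    { resp = E.resp ; 0∈ = E.0∈ ; +-closed = E.+-closed
    ; *-closed = λ s∈F x∈E → E.*-closed (F⊆E s∈F) x∈E }

  Whole : Subset 𝕃
  Whole _ = ⊤

  whole-cardinality : HasCardinality (Restrict setoid Whole) (q ^ suc m)
  whole-cardinality = bijection-cardinality {S = setoid} {T = Restrict setoid Whole} 𝕃-finite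
    (_, tt) (λ e → e) (λ e → e) (λ (x , _) → x , refl)

  -- Extending the empty family inside `E` to length `k` gives a family that spans `E` by counting.
  -- It is then prolonged within 𝕃 to `m` vectors, one short of a basis.
  hyperplane-through-E : ∃ λ (w : Vector Carrier m) → Independent w × E ⊆ Span w
  hyperplane-through-E =
    let u , u-indep , u∈E , _ = independent-extension {m = k} E-finite z≤n ≤-refl [] (λ _ _ _ ()) (λ ())
        w , w-indep , _ , u⊆w = independent-extension {m = m} whole-cardinality k≤m (m≤n⇒m≤1+n ≤-refl)
                                  u u-indep (λ _ → tt)
    in w , w-indep , λ x∈E → u⊆w (⊆-cardinality⇒⊇ {A = Span u} {B = E}
         (IsSubspace.resp (span-isSubspace u)) (span-cardinality u u-indep) E-finite
         (Subspace.span-closed E-isSubspace u u∈E) x∈E)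

  w : Vector Carrier m
  w = proj₁ hyperplane-through-E

  w-independent : Independent w
  w-independent = proj₁ (proj₂ hyperplane-through-E)

  K : Subset 𝕃
  K = Span w

  E⊆K : E ⊆ K
  E⊆K = proj₂ (proj₂ hyperplane-through-E)

  K-cardinality : HasCardinality (Restrict setoid K) (q ^ m)
  K-cardinality = span-cardinality w w-independent

  module K = Subspace (span-isSubspace w)

  outside-K : ∃ λ x → x ∈ Whole × x ∉ K
  outside-K = larger⇒∃∉ {A = Whole} {K} K.resp whole-cardinality K-cardinality
    (^-monoʳ-< q (2≤cardinality F-subfield F-finite) (n<1+n m))

  x₀ : Carrier
  x₀ = proj₁ outside-K

  x₀∉K : x₀ ∉ K
  x₀∉K = proj₂ (proj₂ outside-K)

  -- The coefficient of `x₀` is the value at `x` of a linear functional with kernel `K`.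
  decompose : ∀ x → ∃ λ f → f ∈ F × ∃ λ y → y ∈ K × x ≈ f * x₀ + y
  decompose x =
    let s , s∈F , x≈ = ⊆-cardinality⇒⊇ {A = Span (x₀ ∷ w)} {B = Whole}
                         (IsSubspace.resp (span-isSubspace (x₀ ∷ w)))
                         (span-cardinality (x₀ ∷ w) (independent-∷ w-independent x₀∉K))
                         whole-cardinality (λ _ → tt) {x} tt
    in s zero , s∈F zero , tail s ∙ w , (tail s , s∈F ∘ suc , refl) , x≈

  -- With `f` the `x₀`-coefficient of `a * x₀`, the multiplier `a - f` carries both `x₀` and `K`
  -- into `K`, hence all of 𝕃. Were it invertible, `x₀` would lie in `K`; so `a` equals `f`.
  stabilizer⊆F : ∀ {a} → (∀ {x} → x ∈ K → a * x ∈ K) → a ∈ F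
  stabilizer⊆F {a} aK⊆K = F.resp (sym (x-y≈0⇒x≈y a-f≈0)) f∈F
    where
    f = proj₁ (decompose (a * x₀))
    f∈F = proj₁ (proj₂ (decompose (a * x₀)))
    y = proj₁ (proj₂ (proj₂ (decompose (a * x₀))))
    y∈K = proj₁ (proj₂ (proj₂ (proj₂ (decompose (a * x₀)))))
    ax₀≈ = proj₂ (proj₂ (proj₂ (proj₂ (decompose (a * x₀)))))
    [a-f]x₀∈K : (a - f) * x₀ ∈ K
    [a-f]x₀∈K = K.resp (begin
      y                          ≈⟨ xyx⁻¹≈y (f * x₀) y ⟨
      (f * x₀ + y) - f * x₀      ≈⟨ +-congʳ ax₀≈ ⟨
      a * x₀ - f * x₀            ≈⟨ +-congˡ (-‿distribˡ-* f x₀) ⟩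
      a * x₀ + - f * x₀          ≈⟨ distribʳ _ _ _ ⟨
      (a - f) * x₀               ∎) y∈K
    [a-f]K⊆K : ∀ {x} → x ∈ K → (a - f) * x ∈ K
    [a-f]K⊆K x∈K = K.resp (sym (distribʳ _ _ _)) (K.+-closed (aK⊆K x∈K) (K.*-closed (F.-‿closed f∈F) x∈K))
    [a-f]𝕃⊆K : ∀ x → (a - f) * x ∈ K
    [a-f]𝕃⊆K x = let g , g∈F , z , z∈K , x≈ = decompose x in K.resp
      (begin
        g * ((a - f) * x₀) + (a - f) * z
          ≈⟨ solve 4 (λ g b x z → g :* (b :* x) :+ b :* z := b :* (g :* x :+ z)) refl g (a - f) x₀ z ⟩
        (a - f) * (g * x₀ + z)
          ≈⟨ *-congˡ x≈ ⟨
        (a - f) * x ∎)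
      (K.+-closed (K.*-closed g∈F [a-f]x₀∈K) ([a-f]K⊆K z∈K))
    a-f≈0 : a - f ≈ 0#
    a-f≈0 = decidable-stable ((a - f) ≟ 0#) λ a-f≉0 →
      let b , ab≈1 = inverse a-f≉0 in
      x₀∉K (K.resp (cancel-inverse ab≈1 x₀) ([a-f]𝕃⊆K (b * x₀)))

  -- If a ∉ E, then E + a E is all of 𝕃 by counting, so it cannot lie in K.
  multiplier∈E : ∀ {a} → (∀ {e} → e ∈ E → a * e ∈ K) → a ∈ E
  multiplier∈E {a} aE⊆K = decidable-stable (∈-dec _≟_ {A = E} E.resp E-finite a) λ a∉E →
    let s , x₀≈ = injection⇒surjection {S = ≋-setoid (Restrict setoid E) 2} {T = setoid}
                    (≋-cardinality E-finite 2) 𝕃-finite value (λ {s} {t} → value-injective a∉E {s} {t})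
                    -- Here `suc m ≡ k ℕ.* 2` enters: 𝕃 has exactly as many elements as there are
                    -- pairs from `E`, so the injective `value` reaches `x₀`.
                    (≤-reflexive (≡.trans (≡.cong (q ^_) 1+m≡2k) (≡.sym (^-*-assoc q k 2)))) x₀
    in x₀∉K (K.resp x₀≈ (K.+-closed (E⊆K (proj₂ (s zero))) (aE⊆K (proj₂ (s (suc zero))))))
    where
    value : Vector (Σ Carrier E) 2 → Carrier
    value s = proj₁ (s zero) + a * proj₁ (s (suc zero))
    module E-closure = Subspace E-isSubspace
    value-injective : a ∉ E → ∀ {s t} → value s ≈ value t → ∀ i → proj₁ (s i) ≈ proj₁ (t i)
    value-injective a∉E {s} {t} eq = λ { zero → first ; (suc zero) → second }
      where
      e = proj₁ (s zero)
      e′ = proj₁ (s (suc zero))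
      d = proj₁ (t zero)
      d′ = proj₁ (t (suc zero))
      a[e′-d′]≈d-e : a * (e′ - d′) ≈ d - e
      a[e′-d′]≈d-e = begin
        a * (e′ - d′)                              ≈⟨ +-identityˡ _ ⟨
        0# + a * (e′ - d′)                         ≈⟨ +-congʳ (-‿inverseʳ e) ⟨
        (e - e) + a * (e′ - d′)
          ≈⟨ solve 5 (λ e -e a e′ -d′ → (e :+ -e) :+ a :* (e′ :+ -d′)
               := (e :+ a :* e′) :+ (-e :+ a :* -d′)) refl e (- e) a e′ (- d′) ⟩
        (e + a * e′) + (- e + a * - d′)            ≈⟨ +-congʳ eq ⟩
        (d + a * d′) + (- e + a * - d′)
          ≈⟨ solve 5 (λ d a d′ -e -d′ → (d :+ a :* d′) :+ (-e :+ a :* -d′)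
               := (d :+ -e) :+ a :* (d′ :+ -d′)) refl d a d′ (- e) (- d′) ⟩
        (d - e) + a * (d′ - d′)
          ≈⟨ +-congˡ (trans (*-congˡ (-‿inverseʳ d′)) (zeroʳ a)) ⟩
        (d - e) + 0#                               ≈⟨ +-identityʳ _ ⟩
        d - e                                      ∎
      -- Otherwise `a` would be the quotient of `d - e` by `e′ - d′`, an element of `E`.
      second : e′ ≈ d′
      second = decidable-stable (e′ ≟ d′) λ e′≉d′ →
        let e′-d′∈E = E-closure.-‿closed (proj₂ (s (suc zero))) (proj₂ (t (suc zero)))
            b , [e′-d′]b≈1 = inverse (λ eq → e′≉d′ (x-y≈0⇒x≈y eq))
        in a∉E (E.resp (begin
             (d - e) * b           ≈⟨ *-congʳ a[e′-d′]≈d-e ⟨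
             a * (e′ - d′) * b     ≈⟨ *-assoc _ _ _ ⟩
             a * ((e′ - d′) * b)   ≈⟨ trans (*-congˡ [e′-d′]b≈1) (*-identityʳ a) ⟩
             a                     ∎)
           (E.*-closed (E-closure.-‿closed (proj₂ (t zero)) (proj₂ (s zero)))
             (E.inv-closed e′-d′∈E [e′-d′]b≈1)))
      first : e ≈ d
      first = sym (x-y≈0⇒x≈y (trans (sym a[e′-d′]≈d-e)
        (trans (*-congˡ (trans (+-congʳ second) (-‿inverseʳ d′))) (zeroʳ a))))

  -- a⁻¹ K, for a nonzero.
  H : Carrier → Subset 𝕃
  H a x = a * x ∈ K

  H-cong : ∀ {a b} → a ≈ b → H a ≐ H b
  H-cong a≈b = K.resp (*-congʳ a≈b) , K.resp (*-congʳ (sym a≈b))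

  H-scale : ∀ {f a} → f ∈ F → ¬ f ≈ 0# → H (f * a) ≐ H a
  H-scale f∈F f≉0 = (λ fax∈K → K.scalar-cancel f∈F f≉0 (K.resp (*-assoc _ _ _) fax∈K))
                  , (λ ax∈K → K.resp (sym (*-assoc _ _ _)) (K.*-closed f∈F ax∈K))

  -- Dividing by `a` carries `K` into `H a`, hence into `H b`; so the quotient of `b` by `a` carries
  -- `K` into itself and `stabilizer⊆F` applies.
  H-⊆⇒scalar : ∀ {a b} → ¬ a ≈ 0# → ¬ b ≈ 0# → H a ⊆ H b →
    ∃ λ f → (f ∈ F × ¬ f ≈ 0#) × f * a ≈ b
  H-⊆⇒scalar {a} {b} a≉0 b≉0 Ha⊆Hb =
    let a′ , aa′≈1 = inverse a≉0 in
    b * a′ ,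
    ( stabilizer⊆F (λ x∈K → K.resp (sym (*-assoc _ _ _))
        (Ha⊆Hb (K.resp (sym (cancel-inverse aa′≈1 _)) x∈K)))
    , *-≉0 b≉0 (xy≈1⇒y≉0 aa′≈1)) ,
    trans (*-assoc b a′ a) (trans (*-congˡ (trans (*-comm a′ a) aa′≈1)) (*-identityʳ b))

  H-isHyperplane : ∀ {a} → ¬ a ≈ 0# → IsHyperplane 𝕃 F m (H a)
  H-isHyperplane {a} a≉0 = subspace , (λ i → a′ * w i) , basis
    where
    a′ = proj₁ (inverse a≉0)
    aa′≈1 = proj₂ (inverse a≉0)
    subspace : IsSubspace 𝕃 F (H a)
    subspace = record
      { resp     = λ x≈y → K.resp (*-congˡ x≈y)
      ; 0∈       = K.resp (sym (zeroʳ a)) K.0∈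
      ; +-closed = λ x∈H y∈H → K.resp (sym (distribˡ _ _ _)) (K.+-closed x∈H y∈H)
      ; *-closed = λ {s} {x} s∈F x∈H → K.resp
          (solve 3 (λ s a x → s :* (a :* x) := a :* (s :* x)) refl s a x) (K.*-closed s∈F x∈H)
      }
    basis : IsBasis 𝕃 F (H a) (λ i → a′ * w i)
    basis = record
      { inside      = λ i → K.resp (sym (cancel-inverse aa′≈1 _)) (generator∈span w i)
      ; spanning    = λ {x} (s , s∈F , ax≈) → s , s∈F ,
          trans (sym (cancel-inverse′ aa′≈1 x)) (trans (*-congˡ ax≈) (sym (∙-*ʳ a′ s w)))
      ; independent = λ s s∈F eq → w-independent s s∈F
          (xy≈0⇒y≈0 (xy≈1⇒y≉0 aa′≈1) (trans (sym (∙-*ʳ a′ s w)) eq))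
      }

  -- Two multipliers a, b for which the products with a basis of U agree modulo K
  -- exist by pigeonhole, and U is then carried into K by their difference.
  hyperplane⇒H : ∀ {U} → IsHyperplane 𝕃 F m U → ∃ λ a → ¬ a ≈ 0# × H a ≐ U
  hyperplane⇒H {U} (U-subspace , v , v-basis) = a - b , a-b≉0 , Ha-b⊆U , U⊆Ha-b
    where
    open IsBasis v-basis
    open IsSubspace U-subspace using () renaming (resp to U-resp)
    -- The classes modulo `K` of the products of `a` with the basis vectors: `q ^ m` possible values
    -- for `q ^ suc m` multipliers, whence the collision.
    coordinates : Carrier → Vector (Σ Carrier F) m
    coordinates a i = let f , f∈F , _ = decompose (a * v i) in f , f∈F
    collide = collision {S = Coefficients m} {T = setoid} (≋-cardinality F-finite m) 𝕃-finite
      coordinates (^-monoʳ-< q (2≤cardinality F-subfield F-finite) (n<1+n m))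
    a = proj₁ collide
    b = proj₁ (proj₂ collide)
    a-b≉0 : ¬ a - b ≈ 0#
    a-b≉0 eq = proj₁ (proj₂ (proj₂ collide)) (x-y≈0⇒x≈y eq)
    agree : ∀ i → proj₁ (coordinates a i) ≈ proj₁ (coordinates b i)
    agree = proj₂ (proj₂ (proj₂ collide))
    v∈Ha-b : ∀ i → v i ∈ H (a - b)
    v∈Ha-b i =
      let f , _ , y , y∈K , av≈ = decompose (a * v i)
          g , _ , z , z∈K , bv≈ = decompose (b * v i)
      in K.resp (begin
        y - z                                  ≈⟨ +-identityˡ _ ⟨
        0# + (y - z)
          ≈⟨ +-congʳ (trans (+-congʳ (*-congʳ (agree i))) (-‿inverseʳ (g * x₀))) ⟨
        (f * x₀ - g * x₀) + (y - z)
          ≈⟨ solve 4 (λ u y -v -z → (u :+ -v) :+ (y :+ -z) := (u :+ y) :+ (-v :+ -z))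
               refl (f * x₀) y (- (g * x₀)) (- z) ⟩
        (f * x₀ + y) + (- (g * x₀) - z)  ≈⟨ +-congˡ (-‿+-comm (g * x₀) z) ⟩
        (f * x₀ + y) - (g * x₀ + z)      ≈⟨ +-cong av≈ (-‿cong bv≈) ⟨
        a * v i - b * v i                ≈⟨ +-congˡ (-‿distribˡ-* b (v i)) ⟩
        a * v i + - b * v i              ≈⟨ distribʳ _ _ _ ⟨
        (a - b) * v i                    ∎) (K.-‿closed y∈K z∈K)
    U⊆Ha-b : U ⊆ H (a - b)
    U⊆Ha-b x∈U = Subspace.span-closed (proj₁ (H-isHyperplane a-b≉0)) v v∈Ha-b (spanning x∈U)
    U-cardinality : HasCardinality (Restrict setoid (Span v)) (q ^ m)
    U-cardinality = span-cardinality v independent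
    -- Multiplication by `a - b` injects the span of `v` into `K`; both have `q ^ m` elements, so
    -- every product in `K` comes from `U`.
    Ha-b⊆U : H (a - b) ⊆ U
    Ha-b⊆U {x} x∈H =
      let (y , y∈v) , [a-b]y≈ = injection⇒surjection
             {S = Restrict setoid (Span v)} {T = Restrict setoid K} U-cardinality K-cardinality
             (λ (y , y∈v) → (a - b) * y ,
               Subspace.span-closed (proj₁ (H-isHyperplane a-b≉0)) v v∈Ha-b y∈v)
             (*-cancelˡ-≉0 a-b≉0) ≤-refl ((a - b) * x , x∈H)
      in U-resp (*-cancelˡ-≉0 a-b≉0 [a-b]y≈) (Subspace.span-closed U-subspace v inside y∈v)

  -- The counting scheme shared by both claims. The multiplier `a` is normalised to `u = a * t′`,
  -- with `t′` a nonzero vector of the given block, so that the incidence conditions become `u ∈ S`.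
  -- Proportional `u` give the same hyperplane, and the orbits of `F*` on `S` are counted.
  H-family-cardinality : ∀ {p r n} {S : Pred Carrier p} → HasCardinality (Restrict setoid S) n →
    (∀ {u} → u ∈ S → ¬ u ≈ 0#) → S Respects _≈_ →
    (∀ {f u} → f ∈ F → ¬ f ≈ 0# → u ∈ S → f * u ∈ S) →
    ∀ {t t′} → t * t′ ≈ 1# → {Q : Pred (Subset 𝕃) r} →
    (∀ {u} → u ∈ S → Q (H (u * t))) → (∀ {U} → Q U → ∃ λ a → H a ≐ U × a * t′ ∈ S) →
    HasCardinalityRatio (Restrict (subsets 𝕃) Q) n (q ∸ 1)
  H-family-cardinality {S = S} S-finite S≉0 S-resp S-scale {t} {t′} tt′≈1 {Q} Q-H H-Q =
    orbits-cardinality {S = Restrict setoid S} {X = Restrict (subsets 𝕃) Q}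
      S-finite (subfield∖0-cardinality F-subfield F-finite)
      (λ (u , u∈S) → H (u * t) , Q-H u∈S)
      (λ (U , QU) → let a , Ha≐U , at′∈S = H-Q QU in
        (a * t′ , at′∈S) , ≐-trans (H-cong (at′t≈a a)) Ha≐U)
      (λ (f , f∈F , f≉0) (u , u∈S) → f * u , S-scale f∈F f≉0 u∈S)
      (λ f≈g → *-congʳ f≈g)
      (λ { {x = u , u∈S} eq → *-cancelˡ-≉0 (S≉0 u∈S) (trans (*-comm _ _) (trans eq (*-comm _ _))) })
      (λ u≈v → H-cong (*-congʳ u≈v))
      (λ (f , f∈F , f≉0) (u , _) → ≐-trans (H-cong (*-assoc f u t)) (H-scale f∈F f≉0))
      (λ { {u , u∈S} {v , v∈S} Hut≐Hvt →
        let f , f∈F∖0 , fut≈vt = H-⊆⇒scalar (*-≉0 (S≉0 u∈S) t≉0) (*-≉0 (S≉0 v∈S) t≉0) (proj₁ Hut≐Hvt)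
        in (f , f∈F∖0) , *-cancelˡ-≉0 t≉0
             (trans (*-comm t _) (trans (*-assoc f u t) (trans fut≈vt (*-comm v t)))) })
    where
    open Setoid (subsets 𝕃) using () renaming (trans to ≐-trans)
    t≉0 : ¬ t ≈ 0#
    t≉0 = xy≈1⇒y≉0 (trans (*-comm t′ t) tt′≈1)
    at′t≈a : ∀ a → a * t′ * t ≈ a
    at′t≈a a = cancel-right (trans (*-comm t′ t) tt′≈1)

  -- The subspaces `W E g` and their incidence with hyperplanes.

  W-intro : ∀ {g e} → e ∈ E → g * e ∈ W 𝕃 E g
  W-intro {g} {e} e∈E with e ≟ 0#
  ... | yes e≈0 = inj₁ (trans (*-congˡ e≈0) (zeroʳ g))
  ... | no  e≉0 = inj₂ (e , e∈E , e≉0 , refl)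

  W-elim : ∀ {g x} → x ∈ W 𝕃 E g → ∃ λ e → e ∈ E × x ≈ g * e
  W-elim {g} (inj₁ x≈0)               = 0# , E.0∈ , trans x≈0 (sym (zeroʳ g))
  W-elim     (inj₂ (e , e∈E , _ , x≈)) = e , e∈E , x≈

  W-resp : ∀ {g} → W 𝕃 E g Respects _≈_
  W-resp x≈y (inj₁ x≈0)                 = inj₁ (trans (sym x≈y) x≈0)
  W-resp x≈y (inj₂ (e , e∈E , e≉0 , x≈)) = inj₂ (e , e∈E , e≉0 , trans (sym x≈y) x≈)

  W-⊆ : ∀ {g h e} → e ∈ E → g ≈ h * e → W 𝕃 E g ⊆ W 𝕃 E h
  W-⊆ e∈E g≈he x∈W = let d , d∈E , x≈gd = W-elim x∈W in
    W-resp (sym (trans x≈gd (trans (*-congʳ g≈he) (*-assoc _ _ d)))) (W-intro (E.*-closed e∈E d∈E))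

  W-same : ∀ {g h e} → e ∈ E → ¬ e ≈ 0# → g ≈ h * e → SameBlock 𝕃 E g h
  W-same {h = h} e∈E e≉0 g≈he = let d , ed≈1 = inverse e≉0 in
    W-⊆ e∈E g≈he ,
    W-⊆ (E.inv-closed e∈E ed≈1)
      (sym (trans (*-congʳ g≈he) (trans (*-assoc h _ d) (trans (*-congˡ ed≈1) (*-identityʳ h)))))

  -- The ratio of `h` to `g` is that of `a * h` to `a * g`, hence lies in `E*`. With `W⊆H⇒∈E` this
  -- says that a hyperplane contains at most one of the subspaces `W`.
  same-block : ∀ {a h g} → ¬ a ≈ 0# → ¬ h ≈ 0# → ¬ g ≈ 0# → a * h ∈ E → a * g ∈ E →
    SameBlock 𝕃 E h g
  same-block {a} {h} {g} a≉0 h≉0 g≉0 ah∈E ag∈E = let b , [ag]b≈1 = inverse (*-≉0 a≉0 g≉0) in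
    W-same (E.*-closed ah∈E (E.inv-closed ag∈E [ag]b≈1)) (*-≉0 (*-≉0 a≉0 h≉0) (xy≈1⇒y≉0 [ag]b≈1))
      (sym (begin
        g * (a * h * b)
          ≈⟨ solve 4 (λ g a h b → g :* (a :* h :* b) := h :* (a :* g :* b)) refl g a h b ⟩
        h * (a * g * b)     ≈⟨ *-congˡ [ag]b≈1 ⟩
        h * 1#              ≈⟨ *-identityʳ h ⟩
        h                   ∎))

  W⊆H⇒∈E : ∀ {a g} → W 𝕃 E g ⊆ H a → a * g ∈ E
  W⊆H⇒∈E W⊆H = multiplier∈E (λ e∈E → K.resp (sym (*-assoc _ _ _)) (W⊆H (W-intro e∈E)))

  ∈E⇒W⊆H : ∀ {a g} → a * g ∈ E → W 𝕃 E g ⊆ H a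
  ∈E⇒W⊆H ag∈E x∈W = let e , e∈E , x≈ge = W-elim x∈W in
    K.resp (trans (*-assoc _ _ e) (*-congˡ (sym x≈ge))) (E⊆K (E.*-closed ag∈E e∈E))

  -- Counting the hyperplanes through a point.

  module _ {P : Subset 𝕃} (P-point : IsPoint 𝕃 F P) where
    open IsBasis (proj₂ (proj₂ P-point))

    generator : Carrier
    generator = proj₁ (proj₂ P-point) zero

    generator∈P : generator ∈ P
    generator∈P = inside zero

    generator≉0 : ¬ generator ≈ 0#
    generator≉0 p≈0 = 1≉0 (independent (λ _ → 1#) (λ _ → F.1∈)
      (trans (+-identityʳ _) (trans (*-congˡ p≈0) (zeroʳ 1#))) zero)

    P-elim : ∀ {x} → x ∈ P → ∃ λ f → f ∈ F × x ≈ f * generator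
    P-elim x∈P = let s , s∈F , x≈ = spanning x∈P in s zero , s∈F zero , trans x≈ (+-identityʳ _)

    generator∈W⇒ : ∀ {g} → generator ∈ W 𝕃 E g → ∃ λ e → e ∈ E × ¬ e ≈ 0# × generator ≈ g * e
    generator∈W⇒ (inj₁ p≈0) = contradiction p≈0 generator≉0
    generator∈W⇒ (inj₂ e)   = e

    -- The generator of the point represents its own block because `F ⊆ E`; any other representative
    -- differs from it by a factor in `E*`.
    unique-block : ∃! (SameBlock 𝕃 E) (InPointBlock 𝕃 E P)
    unique-block = generator ,
      (generator≉0 , λ x∈P → let f , f∈F , x≈ = P-elim x∈P in
        W-resp (sym (trans x≈ (*-comm f generator))) (W-intro (F⊆E f∈F))) ,
      λ (_ , P⊆W) → let e , e∈E , e≉0 , p≈ge = generator∈W⇒ (P⊆W generator∈P) in W-same e∈E e≉0 p≈ge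

    module _ {g : Carrier} (g-block : InPointBlock 𝕃 E P g) where
      private
        g≉0 = proj₁ g-block
        P⊆W = proj₂ g-block

      -- Normalised by `u = a * g`: the hyperplane contains `W E g` exactly when `u` lies in `E`, so
      -- `u` runs through `E*`.
      block-cardinality : HasCardinalityRatio
        (Restrict (subsets 𝕃) (λ U → InHyperplaneBlock 𝕃 F E m g U × P ⊆ U)) (q ^ k ∸ 1) (q ∸ 1)
      block-cardinality = let g′ , gg′≈1 = inverse g≉0 in
        H-family-cardinality (subfield∖0-cardinality E-subfield E-finite) proj₂
          (λ x≈y (x∈E , x≉0) → E.resp x≈y x∈E , λ y≈0 → x≉0 (trans x≈y y≈0))
          (λ f∈F f≉0 (x∈E , x≉0) → E.*-closed (F⊆E f∈F) x∈E , *-≉0 f≉0 x≉0)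
          (trans (*-comm g′ g) gg′≈1)
          (λ (u∈E , u≉0) →
            let W⊆H = ∈E⇒W⊆H (E.resp (sym (cancel-right (trans (*-comm g′ g) gg′≈1))) u∈E) in
            (H-isHyperplane (*-≉0 u≉0 (xy≈1⇒y≉0 gg′≈1)) , λ {x} → W⊆H {x}) ,
            λ {x} x∈P → W⊆H (P⊆W x∈P))
          (λ ((U-hyp , W⊆U) , _) → let a , a≉0 , Ha≐U = hyperplane⇒H U-hyp in
            a , Ha≐U , W⊆H⇒∈E (λ x∈W → proj₂ Ha≐U (W⊆U x∈W)) , *-≉0 a≉0 g≉0)

      -- Normalised by `u = a * p` with `p` the generator: `u ∈ K` says that the hyperplane contains
      -- the point, and `u ∉ E` that it does not contain the whole of the point's block subspace.
      other-blocks-cardinality : HasCardinalityRatio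
        (Restrict (subsets 𝕃) (λ U → InOtherHyperplaneBlock 𝕃 F E m g U × P ⊆ U))
        (q ^ m ∸ q ^ k) (q ∸ 1)
      other-blocks-cardinality = let p = generator ; p′ , pp′≈1 = inverse generator≉0 in
        H-family-cardinality
          (difference-cardinality _≟_ {A = K} {B = E} K.resp E.resp K-cardinality E-finite E⊆K)
          K∖E≉0
          (λ x≈y (x∈K , x∉E) → K.resp x≈y x∈K , λ y∈E → x∉E (E.resp (sym x≈y) y∈E))
          (λ f∈F f≉0 (x∈K , x∉E) → K.*-closed f∈F x∈K ,
            λ fx∈E → x∉E (Subspace.scalar-cancel E-isSubspace f∈F f≉0 fx∈E))
          (trans (*-comm p′ p) pp′≈1)
          (λ {u} (u∈K , u∉E) →
            let a≉0 = *-≉0 (K∖E≉0 (u∈K , u∉E)) (xy≈1⇒y≉0 pp′≈1)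
                -- The block of `H a` is that of the inverse of `a`: their product 1 lies in `E`.
                h , ah≈1 = inverse a≉0
                up′p≈u = cancel-right {u} (trans (*-comm p′ p) pp′≈1)
                W⊆H = ∈E⇒W⊆H (E.resp (sym ah≈1) E.1∈)
            in (h , xy≈1⇒y≉0 ah≈1
                 , (λ (_ , Wg⊆Wh) → let e , e∈E , _ , p≈he = generator∈W⇒ (Wg⊆Wh (P⊆W generator∈P)) in
                     u∉E (E.resp (sym (trans (sym up′p≈u)
                       (trans (*-congˡ p≈he) (cancel-inverse ah≈1 e)))) e∈E))
                 , H-isHyperplane a≉0 , λ {x} → W⊆H {x})
               , λ {x} x∈P → let f , f∈F , x≈ = P-elim x∈P in
                   K.resp (sym (trans (*-congˡ x≈) (trans (x*[y*z]≈y*[x*z] _ f p) (*-congˡ up′p≈u))))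
                     (K.*-closed f∈F u∈K))
          (λ ((h , h≉0 , different , U-hyp , W⊆U) , P⊆U) →
            let a , a≉0 , Ha≐U = hyperplane⇒H U-hyp
                ah∈E = W⊆H⇒∈E (λ x∈W → proj₂ Ha≐U (W⊆U x∈W))
                e , e∈E , e≉0 , p≈ge = generator∈W⇒ (P⊆W generator∈P)
            -- As `p` is `g * e` with `e` in `E*`, having `a * p` in `E` would force `a * g ∈ E`;
            -- next to `a * h ∈ E` this merges the two blocks.
            in a , Ha≐U , proj₂ Ha≐U (P⊆U generator∈P) , λ ap∈E → different
                 (same-block a≉0 h≉0 g≉0 ah∈E (E-cancel e∈E e≉0 (E.resp (begin
                   a * generator   ≈⟨ *-congˡ p≈ge ⟩
                   a * (g * e)     ≈⟨ x*[y*z]≈z*[x*y] a g e ⟩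
                   e * (a * g)     ∎) ap∈E))))
        where
        K∖E≉0 : ∀ {u} → u ∈ K × u ∉ E → ¬ u ≈ 0#
        K∖E≉0 (_ , u∉E) u≈0 = u∉E (E.resp (sym u≈0) E.0∈)

-- Halving `suc m`, and the conclusion.

1+odd≡[1+odd]/2*2 : ∀ {m} → 2 ∤ m → suc m ≡ suc m / 2 ℕ.* 2
1+odd≡[1+odd]/2*2 {m} 2∤m with suc m % 2 | m%n<n (suc m) 2 | m≡m%n+[m/n]*n (suc m) 2
... | 0           | _            | eq = eq
... | 1           | _            | eq = contradiction (divides (suc m / 2) (ℕ-suc-injective eq)) 2∤m
... | suc (suc _) | s≤s (s≤s ()) | _

theorem14 : ∀ {c ℓ₁ ℓ₂} (q m : ℕ) → IsPrimePower q → 1 ≤ m → 2 ∤ m →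
  (𝕃 : HeytingField c ℓ₁ ℓ₂) → HasCardinality (fieldSetoid 𝕃) (q ^ suc m) →
  (F : Subset 𝕃) → IsSubfield 𝕃 F → HasCardinality (Restrict (fieldSetoid 𝕃) F) q →
  (E : Subset 𝕃) → IsSubfield 𝕃 E → HasCardinality (Restrict (fieldSetoid 𝕃) E) (q ^ (suc m / 2)) →
  (P : Subset 𝕃) → IsPoint 𝕃 F P →
  ∃! (SameBlock 𝕃 E) (InPointBlock 𝕃 E P) ×
  (∀ g → InPointBlock 𝕃 E P g →
    HasCardinalityRatio
      (Restrict (subsets 𝕃) (λ H → InHyperplaneBlock 𝕃 F E m g H × P ⊆ H))
      (q ^ (suc m / 2) ∸ 1) (q ∸ 1) ×
    HasCardinalityRatio
      (Restrict (subsets 𝕃) (λ H → InOtherHyperplaneBlock 𝕃 F E m g H × P ⊆ H))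
      (q ^ m ∸ q ^ (suc m / 2)) (q ∸ 1))
theorem14 q m _ _ 2∤m 𝕃 𝕃-finite F F-subfield F-finite E E-subfield E-finite P P-point =
  unique-block P-point ,
  λ g g-block → block-cardinality P-point g-block , other-blocks-cardinality P-point g-block
  where
  open Hyperplanes 𝕃 {k = suc m / 2} 𝕃-finite F-subfield F-finite E-subfield E-finite
    -- The strict bound `suc m / 2 < suc m` is what leaves room for a hyperplane around `E`.
    (1+odd≡[1+odd]/2*2 2∤m) (≤-pred (m/n<m (suc m) 2 (s≤s (s≤s z≤n))))
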